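{- Let $T$ be a tree on $t$ vertices. For every positive integer $k$ and every graph $G$, either $G$ contains $k$ pairwise vertex-disjoint subgraphs each having a $T$ minor, or there exists a set $X$ of at most $t(k-1)$ vertices of $G$ such that $G-X$ has no $T$ minor.
   Context: All graphs are finite. A graph $H$ is a minor of a graph $G$ if $H$ can be obtained from a subgraph of $G$ by contracting edges. For $X\subseteq V(G)$, $G-X$ denotes the subgraph of $G$ induced by $V(G)\setminus X$. -}

module Defs where

open import Data.Bool using (Bool; true; false)
open import Data.Nat using (ℕ; _≤_)
open import Data.Fin using (Fin)
open import Data.Fin.Subset using (Subset; _∈_)
open import Data.List using (List; []; _∷_; _++_; [_]; length)
open import Data.List.Relation.Unary.Unique.Propositional using (Unique)
open import Data.Product using (Σ; _×_; ∃)
open import Data.Unit using (⊤)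
open import Data.Empty using (⊥)
open import Relation.Nullary using (¬_)
open import Relation.Binary.PropositionalEquality using (_≡_; _≢_)
open import Relation.Binary.Construct.Closure.ReflexiveTransitive using (Star)

record Graph (n : ℕ) : Set where
  field
    adj    : Fin n → Fin n → Bool
    sym    : ∀ u v → adj u v ≡ true → adj v u ≡ true
    irrefl : ∀ v → adj v v ≡ false
open Graph public

Adj : ∀ {n} → Graph n → Fin n → Fin n → Set
Adj G u v = adj G u v ≡ true

Connected : ∀ {n} → Graph n → Set
Connected G = ∀ u v → Star (Adj G) u v

ConsecAdj : ∀ {n} → Graph n → List (Fin n) → Set
ConsecAdj G [] = ⊤
ConsecAdj G (x ∷ []) = ⊤
ConsecAdj G (x ∷ y ∷ xs) = Adj G x y × ConsecAdj G (y ∷ xs)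

HasCycle : ∀ {n} → Graph n → Set
HasCycle {n} G =
  Σ (Fin n) λ v → Σ (List (Fin n)) λ vs →
    Unique (v ∷ vs) × (2 ≤ length vs) × ConsecAdj G (v ∷ vs ++ [ v ])

IsTree : ∀ {n} → Graph n → Set
IsTree G = Connected G × ¬ HasCycle G

-- H is a minor of the induced subgraph G[P] (P ⊆ V(G)):
-- H is obtained from a subgraph S of G[P] by contracting edges.
-- S has vertex set VS ⊆ P and edge set ES ⊆ E(G) (edges between VS-vertices);
-- a set of edges of S is contracted, and the result is identified with H via
-- the map f : V(S) → V(H) sending each vertex to its contracted class.
-- Thus: f is onto V(H); each class f⁻¹(h) is connected in S using edges of S
-- (the contracted edges); and for distinct a, b of H, ab ∈ E(H) iff S has an
-- edge between the classes of a and b.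
record MinorModel {m n : ℕ} (H : Graph m) (G : Graph n) (P : Subset n) : Set where
  field
    VS      : Subset n
    VS⊆P    : ∀ v → v ∈ VS → v ∈ P
    ES      : Fin n → Fin n → Bool
    ES-sym  : ∀ u v → ES u v ≡ true → ES v u ≡ true
    ES⊆E    : ∀ u v → ES u v ≡ true → Adj G u v × u ∈ VS × v ∈ VS
    f       : Fin n → Fin m
    onto    : ∀ h → Σ (Fin n) λ v → v ∈ VS × f v ≡ h
    classConnected : ∀ u v → u ∈ VS → v ∈ VS → f u ≡ f v →
                     Star (λ x y → ES x y ≡ true × f x ≡ f u × f y ≡ f u) u v
    edges→  : ∀ a b → a ≢ b → Adj H a b →
              Σ (Fin n) λ u → Σ (Fin n) λ v → ES u v ≡ true × f u ≡ a × f v ≡ b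
    edges←  : ∀ u v → ES u v ≡ true → f u ≢ f v → Adj H (f u) (f v)

HasMinorWithin : ∀ {m n} → Graph m → Graph n → Subset n → Set
HasMinorWithin H G P = MinorModel H G P

PairwiseDisjoint : ∀ {k n} → (Fin k → Subset n) → Set
PairwiseDisjoint {k} {n} S = ∀ (i j : Fin k) → i ≢ j → ∀ (v : Fin n) → v ∈ S i → v ∈ S j → ⊥

{-# OPTIONS --safe #-}
module Submission where

-- If G[W] has a T minor, there are A ⊆ W and S with ∣ S ∣ ≤ t such that G[A] has a T minor, G[A ─ S]
-- has none, and no edge joins A ─ S to W ─ A.  Recursing into W ─ A then yields either one more
-- disjoint T minor, or a cover to which S is added (T being connected, a T minor avoiding both
-- lies inside A ─ S or inside W ─ A).
--
-- To find A and S, follow Diestel's proof of the path-width theorem.  Build T one leaf at a time;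
-- after i steps, A is maximal such that its boundary ∂A has at most i vertices and A ─ ∂A induces
-- no T minor, and G[A] contains a model of an i-vertex subtree of T whose branch sets all meet ∂A.
-- A vertex y outside A, adjacent to the right boundary vertex, models the next leaf.  If
-- A ∪ {y} induces a T minor, take S = ∂A ∪ {y}.  Otherwise maximality of A excludes sets with
-- boundary of size ≤ i between A ∪ {y} and its next maximal extension, so Menger's theorem
-- carries all i + 1 roots to the new boundary.

open import Defs
open import Data.Nat using (ℕ; zero; suc; _+_; _≤_; _<_; _*_; _∸_; z≤n; s≤s; s≤s⁻¹; _≤?_; _<?_)
open import Data.Nat.Properties using (≤-refl; ≤-reflexive; ≤-trans; <-≤-trans; ≤-<-trans; ≤⇒≯; ≮⇒≥; ≰⇒>; +-mono-≤; +-monoʳ-≤; m≤m+n; +-comm; +-suc; *-suc; m≤n⇒m≤1+n; module ≤-Reasoning)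
open import Data.Bool using (true)
import Data.Bool.Properties as Bool
open import Data.Fin using (Fin; zero; suc; _≟_; finToFun; funToFin)
open import Data.Fin.Properties using (any?; all?; finToFun-funToFin; ¬∀⟶∃¬)
open import Data.Fin.Subset using (Subset; inside; outside; ∁; ∣_∣; _∈_; _∉_; _⊆_; _⊂_; _∪_; _─_; _-_; ⁅_⁆) renaming (⊤ to full; ⊥ to ∅)
open import Data.Fin.Subset.Properties
open import Data.List using (List; []; _∷_; _++_; [_]; cartesianProduct; allFin)
open import Data.List.Membership.Propositional using () renaming (_∈_ to _∈ˡ_)
open import Data.List.Membership.Propositional.Properties using (∈-cartesianProduct⁺; ∈-allFin)
open import Data.List.Relation.Unary.All using (All; []; _∷_)
import Data.List.Relation.Unary.All as All
open import Data.List.Relation.Unary.All.Properties using (¬Any⇒All¬)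
open import Data.List.Relation.Unary.AllPairs using ([]; _∷_)
open import Data.List.Relation.Unary.Any using (here; there)
import Data.List.Membership.DecPropositional as DecMembership
open import Data.List.Relation.Unary.Unique.Propositional using (Unique)
open import Data.Product using (Σ; ∃; _×_; _,_; proj₁; proj₂)
open import Data.Sum using (_⊎_; inj₁; inj₂; [_,_]′)
open import Data.Unit using (tt)
open import Data.Vec using (_∷_; []; tabulate; here; there)
open import Data.Vec.Properties using (lookup∘tabulate; []=⇒lookup; lookup⇒[]=)
open import Function using (_∘_; id; flip; case_of_)
open import Relation.Nullary using (¬_; Dec; yes; no; does; contradiction; map′; _×-dec_; _→-dec_; _⊎-dec_; ¬?)
open import Relation.Nullary.Decidable using (dec-true; decidable-stable)
open import Relation.Unary using (Pred; Decidable)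
import Relation.Binary as B
open import Relation.Binary.PropositionalEquality using (_≡_; _≢_; refl; trans; cong; subst) renaming (sym to ≡-sym)
open import Relation.Binary.Construct.Closure.ReflexiveTransitive using (Star; ε; _◅_; _◅◅_)
import Relation.Binary.Construct.Closure.ReflexiveTransitive as Star
open import Level using (0ℓ)

private variable
  n t : ℕ

-- Cardinalities and maximal elements among finite subsets

∣p∪q∣≤∣p∣+∣q∣ : (p q : Subset n) → ∣ p ∪ q ∣ ≤ ∣ p ∣ + ∣ q ∣
∣p∪q∣≤∣p∣+∣q∣ [] [] = z≤n
∣p∪q∣≤∣p∣+∣q∣ (outside ∷ p) (outside ∷ q) = ∣p∪q∣≤∣p∣+∣q∣ p q
∣p∪q∣≤∣p∣+∣q∣ (outside ∷ p) (inside ∷ q) =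
  ≤-trans (s≤s (∣p∪q∣≤∣p∣+∣q∣ p q)) (≤-reflexive (≡-sym (+-suc ∣ p ∣ ∣ q ∣)))
∣p∪q∣≤∣p∣+∣q∣ (inside ∷ p) (outside ∷ q) = s≤s (∣p∪q∣≤∣p∣+∣q∣ p q)
∣p∪q∣≤∣p∣+∣q∣ (inside ∷ p) (inside ∷ q) =
  s≤s (≤-trans (∣p∪q∣≤∣p∣+∣q∣ p q) (+-monoʳ-≤ ∣ p ∣ (m≤n⇒m≤1+n ≤-refl)))

x∈p─q⇒x∉q : ∀ (p q : Subset n) {x} → x ∈ p ─ q → x ∉ q
x∈p─q⇒x∉q (_ ∷ p) (inside ∷ q) () here
x∈p─q⇒x∉q (_ ∷ p) (_ ∷ q) (there x∈) (there x∈q) = x∈p─q⇒x∉q p q x∈ x∈q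

∣p∪⁅y⁆∣≤1+∣p∣ : ∀ (p : Subset n) y → ∣ p ∪ ⁅ y ⁆ ∣ ≤ suc ∣ p ∣
∣p∪⁅y⁆∣≤1+∣p∣ p y = begin
  ∣ p ∪ ⁅ y ⁆ ∣     ≤⟨ ∣p∪q∣≤∣p∣+∣q∣ p ⁅ y ⁆ ⟩
  ∣ p ∣ + ∣ ⁅ y ⁆ ∣ ≡⟨ cong (∣ p ∣ +_) (∣⁅x⁆∣≡1 y) ⟩
  ∣ p ∣ + 1         ≡⟨ +-comm ∣ p ∣ 1 ⟩
  suc ∣ p ∣         ∎
  where open ≤-Reasoning

p⊆q∧∣q∣≤∣p∣⇒q⊆p : ∀ {p q : Subset n} → p ⊆ q → ∣ q ∣ ≤ ∣ p ∣ → q ⊆ p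
p⊆q∧∣q∣≤∣p∣⇒q⊆p {p = p} p⊆q q≤p {x} x∈q with x ∈? p
... | yes x∈p = x∈p
... | no  x∉p = contradiction (p⊂q⇒∣p∣<∣q∣ (p⊆q , x , x∈q , x∉p)) (≤⇒≯ q≤p)

∪⁅⁆⁻ : ∀ (p : Subset n) {x y} → x ∈ p ∪ ⁅ y ⁆ → x ∈ p ⊎ x ≡ y
∪⁅⁆⁻ p {y = y} x∈ with x∈p∪q⁻ p ⁅ y ⁆ x∈
... | inj₁ x∈p = inj₁ x∈p
... | inj₂ x∈y = inj₂ (x∈⁅y⁆⇒x≡y y x∈y)

∪⁅⁆⁺ˡ : ∀ {p : Subset n} {x y} → x ∈ p → x ∈ p ∪ ⁅ y ⁆
∪⁅⁆⁺ˡ = x∈p∪q⁺ ∘ inj₁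

∪⁅⁆⁺ʳ : ∀ {p : Subset n} y → y ∈ p ∪ ⁅ y ⁆
∪⁅⁆⁺ʳ y = x∈p∪q⁺ (inj₂ (x∈⁅x⁆ y))

p⊂p∪⁅y⁆ : ∀ {p : Subset n} {y} → y ∉ p → p ⊂ p ∪ ⁅ y ⁆
p⊂p∪⁅y⁆ {y = y} y∉p = ∪⁅⁆⁺ˡ , y , ∪⁅⁆⁺ʳ y , y∉p

-- Fuel step of the recursions below: the strict increase `a < b` pays for one unit of `d`.
shift-bound : ∀ d {a b c} → c ≤ suc d + a → a < b → c ≤ d + b
shift-bound d {a} c≤ a<b =
  ≤-trans c≤ (≤-trans (≤-reflexive (≡-sym (+-suc d a))) (+-monoʳ-≤ d a<b))

maximalSuperset : ∀ {Q : Pred (Subset n) 0ℓ} → Decidable Q → ∀ {A} → Q A →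
  ∃ λ B → A ⊆ B × Q B × (∀ Z → B ⊆ Z → Q Z → Z ⊆ B)
maximalSuperset {n} {Q} Q? {A} qA = go n A qA (m≤m+n n ∣ A ∣)
  where
  go : ∀ d A → Q A → n ≤ d + ∣ A ∣ →
    ∃ λ B → A ⊆ B × Q B × (∀ Z → B ⊆ Z → Q Z → Z ⊆ B)
  go d A qA bound with anySubset? (λ Z → Q? Z ×-dec (A ⊂? Z))
  go d A qA bound | no none = A , id , qA , λ Z A⊆Z qZ {x} x∈Z →
    decidable-stable (x ∈? A) (λ x∉A → none (Z , qZ , A⊆Z , x , x∈Z , x∉A))
  go zero A qA bound | yes (Z , qZ , A⊂Z) =
    contradiction (≤-trans (p⊂q⇒∣p∣<∣q∣ A⊂Z) (∣p∣≤n Z)) (≤⇒≯ bound)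
  go (suc d) A qA bound | yes (Z , qZ , A⊂Z)
    with B , Z⊆B , rest ← go d Z qZ (shift-bound d bound (p⊂q⇒∣p∣<∣q∣ A⊂Z)) =
    B , Z⊆B ∘ proj₁ A⊂Z , rest

-- Decidable comprehension and reachability

does-true : ∀ {A : Set} (a? : Dec A) → does a? ≡ true → A
does-true (yes a) _ = a

comprehension : ∀ {P : Pred (Fin n) 0ℓ} → Decidable P → Subset n
comprehension P? = tabulate (does ∘ P?)

module _ {P : Pred (Fin n) 0ℓ} (P? : Decidable P) where

  ∈-comprehension⁺ : ∀ {x} → P x → x ∈ comprehension P?
  ∈-comprehension⁺ {x} px = lookup⇒[]= x _
    (trans (lookup∘tabulate (does ∘ P?) x) (dec-true (P? x) px))

  ∈-comprehension⁻ : ∀ {x} → x ∈ comprehension P? → P x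
  ∈-comprehension⁻ {x} x∈ = does-true (P? x)
    (trans (≡-sym (lookup∘tabulate (does ∘ P?) x)) ([]=⇒lookup x∈))

-- The reachable set is grown one vertex at a time until it is closed under R.
star? : ∀ {R : B.Rel (Fin n) 0ℓ} → B.Decidable R → B.Decidable (Star R)
star? {n} {R} R? u v = go n ⁅ u ⁆ (x∈⁅x⁆ u)
    (λ x∈ → subst (Star R u) (≡-sym (x∈⁅y⁆⇒x≡y u x∈)) ε) (m≤m+n n _)
  where
  closed-∋ : ∀ {Z : Subset n} → (∀ {x y} → x ∈ Z → R x y → y ∈ Z) →
    ∀ {x y} → x ∈ Z → Star R x y → y ∈ Z
  closed-∋ cl x∈ ε = x∈
  closed-∋ cl x∈ (r ◅ rs) = closed-∋ cl (cl x∈ r) rs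
  go : ∀ d Z → u ∈ Z → (∀ {x} → x ∈ Z → Star R u x) → n ≤ d + ∣ Z ∣ → Dec (Star R u v)
  go d Z u∈ reach bound with any? (λ x → any? (λ y → (x ∈? Z) ×-dec (R? x y ×-dec ¬? (y ∈? Z))))
  go d Z u∈ reach bound | no none = map′ reach
    (closed-∋ (λ {x} {y} x∈ r → decidable-stable (y ∈? Z) (λ y∉ → none (x , y , x∈ , r , y∉))) u∈)
    (v ∈? Z)
  go zero Z u∈ reach bound | yes (x , y , x∈ , r , y∉) =
    contradiction (≤-trans (p⊂q⇒∣p∣<∣q∣ (p⊂p∪⁅y⁆ y∉)) (∣p∣≤n (Z ∪ ⁅ y ⁆))) (≤⇒≯ bound)
  go (suc d) Z u∈ reach bound | yes (x , y , x∈ , r , y∉) =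
    go d (Z ∪ ⁅ y ⁆) (∪⁅⁆⁺ˡ u∈)
      (λ z∈ → [ reach , (λ { refl → reach x∈ ◅◅ (r ◅ ε) }) ]′ (∪⁅⁆⁻ Z z∈))
      (shift-bound d bound (p⊂q⇒∣p∣<∣q∣ (p⊂p∪⁅y⁆ y∉)))

-- Connected vertex sets in acyclic graphs

adj? : (G : Graph n) → B.Decidable (Adj G)
adj? G u v = adj G u v Bool.≟ true

InducedEdge : Graph n → Subset n → B.Rel (Fin n) 0ℓ
InducedEdge G L x y = Adj G x y × x ∈ L × y ∈ L

InducedConnected : Graph n → Subset n → Set
InducedConnected G L = ∀ {a b} → a ∈ L → b ∈ L → Star (InducedEdge G L) a b

module _ (T : Graph t) where

  star-mono : ∀ {L h a b} → Star (InducedEdge T L) a b → Star (InducedEdge T (L ∪ ⁅ h ⁆)) a b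
  star-mono = Star.map λ (xy , x∈ , y∈) → xy , ∪⁅⁆⁺ˡ x∈ , ∪⁅⁆⁺ˡ y∈

  -- The neighbour is asked for only in the presence of some `a ∈ L`, so the first vertex can be
  -- added to an empty `L` as well.
  induced-insert : ∀ {L h} → InducedConnected T L →
    (∀ {a} → a ∈ L → ∃ λ b → b ∈ L × Adj T b h) → InducedConnected T (L ∪ ⁅ h ⁆)
  induced-insert {L} {h} conn nbr {a} {b} a∈ b∈ with ∪⁅⁆⁻ L a∈ | ∪⁅⁆⁻ L b∈
  ... | inj₁ a∈L | inj₁ b∈L = star-mono (conn a∈L b∈L)
  ... | inj₁ a∈L | inj₂ refl = let c , c∈L , ch = nbr a∈L in
    star-mono (conn a∈L c∈L) ◅◅ ((ch , ∪⁅⁆⁺ˡ c∈L , b∈) ◅ ε)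
  ... | inj₂ refl | inj₁ b∈L = let c , c∈L , ch = nbr b∈L in
    (sym T c h ch , a∈ , ∪⁅⁆⁺ˡ c∈L) ◅ star-mono (conn c∈L b∈L)
  ... | inj₂ refl | inj₂ refl = ε

  exit-edge : ∀ {L : Subset t} {a b} → Star (Adj T) a b → a ∈ L → b ∉ L →
    ∃ λ x → ∃ λ y → x ∈ L × y ∉ L × Adj T x y
  exit-edge ε a∈ b∉ = contradiction a∈ b∉
  exit-edge {L} {a} (_◅_ {j = c} ac cb) a∈ b∉ with c ∈? L
  ... | yes c∈ = exit-edge cb c∈ b∉
  ... | no c∉ = a , c , a∈ , c∉ , ac

  data Walk (z : Fin t) : Fin t → List (Fin t) → Set where
    stop : Walk z z []
    step : ∀ {x y l} → Adj T x y → Walk z y l → Walk z x (y ∷ l)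

  closed-walk : ∀ {z h x l} → Adj T z h → Walk z x l → ConsecAdj T ((x ∷ l) ++ [ h ])
  closed-walk zh stop = zh , tt
  closed-walk zh (step xy w) = xy , closed-walk zh w

  SimpleWalk : Subset t → Fin t → Fin t → Set
  SimpleWalk L z x = ∃ λ l → Walk z x l × Unique (x ∷ l) × All (_∈ L) (x ∷ l)

  -- Loop erasure: a walk that comes back to `x` is replaced by its tail from `x`.
  restart : ∀ {L z x y l} → x ∈ˡ y ∷ l → Walk z y l → Unique (y ∷ l) → All (_∈ L) (y ∷ l) →
    SimpleWalk L z x
  restart (here refl) w u a = _ , w , u , a
  restart (there x∈) (step _ w) (_ ∷ u) (_ ∷ a) = restart x∈ w u a

  simple-walk : ∀ {L z x} → z ∈ L → Star (InducedEdge T L) x z → SimpleWalk L z x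
  simple-walk z∈ ε = [] , stop , [] ∷ [] , z∈ ∷ []
  simple-walk {x = x} z∈ (_◅_ {j = y} (xy , x∈ , _) yz)
    with l , w , u , a ← simple-walk z∈ yz | DecMembership._∈?_ _≟_ x (y ∷ l)
  ... | yes x∈l = restart x∈l w u a
  ... | no x∉l = y ∷ l , step xy w , ¬Any⇒All¬ (y ∷ l) x∉l ∷ u , x∈ ∷ a

  -- A simple path in `L` from `a` to `b` with at least two vertices would close to a cycle through
  -- `h`. Hence a new leaf of the growing subtree needs an edge to one branch set only.
  unique-neighbour : ∀ {L h a b} → ¬ HasCycle T → InducedConnected T L → h ∉ L →
    a ∈ L → b ∈ L → Adj T a h → Adj T b h → a ≡ b
  unique-neighbour {L} {h} {a} acyclic conn h∉ a∈ b∈ ah bh with simple-walk b∈ (conn a∈ b∈)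
  ... | [] , stop , _ = refl
  ... | c ∷ l , w , u , al = contradiction
    (h , a ∷ c ∷ l
       , All.map (λ { x∈ refl → h∉ x∈ }) al ∷ u
       , s≤s (s≤s z≤n)
       , sym T a h ah , closed-walk bh w) acyclic

-- Models of induced subgraphs of `T` in induced subgraphs of `G`

module Models {t n : ℕ} (T : Graph t) (G : Graph n) where

  ClassEdge : Subset n → (Fin n → Fin t) → Fin t → B.Rel (Fin n) 0ℓ
  ClassEdge V f a x y = Adj G x y × (x ∈ V × f x ≡ a) × (y ∈ V × f y ≡ a)

  -- A model of T[L] in G[A]: the branch set of a ∈ L is { v ∈ V ∣ f v ≡ a }.
  record IsModel (L : Subset t) (A V : Subset n) (f : Fin n → Fin t) : Set where
    field
      inA       : V ⊆ A
      label     : ∀ {v} → v ∈ V → f v ∈ L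
      onto      : ∀ a → a ∈ L → ∃ λ v → v ∈ V × f v ≡ a
      connected : ∀ a u v → u ∈ V × f u ≡ a → v ∈ V × f v ≡ a → Star (ClassEdge V f a) u v
      edges     : ∀ a b → a ∈ L → b ∈ L → Adj T a b →
                  ∃ λ u → ∃ λ v → Adj G u v × (u ∈ V × f u ≡ a) × (v ∈ V × f v ≡ b)

  Minor : Subset n → Set
  Minor A = ∃ λ V → ∃ λ f → IsModel full A V f

  model-within : ∀ {L A B V f} → V ⊆ B → IsModel L A V f → IsModel L B V f
  model-within V⊆B M = record
    { inA = V⊆B ; label = label ; onto = onto ; connected = connected ; edges = edges }
    where open IsModel M

  model-mono : ∀ {L A B V f} → A ⊆ B → IsModel L A V f → IsModel L B V f
  model-mono A⊆B M = model-within (A⊆B ∘ IsModel.inA M) M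

  minor-mono : ∀ {A B} → A ⊆ B → Minor A → Minor B
  minor-mono A⊆B (V , f , M) = V , f , model-mono A⊆B M

  -- `minor?` enumerates labellings by finite codes, and decoding the code of `f` gives back `f`
  -- only pointwise.
  model-cong : ∀ {L A V f g} → (∀ v → f v ≡ g v) → IsModel L A V f → IsModel L A V g
  model-cong {L} {V = V} {f} {g} f≗g M = record
    { inA = inA
    ; label = λ {v} v∈ → subst (_∈ L) (f≗g v) (label v∈)
    ; onto = λ a a∈ → let v , c = onto a a∈ in v , to c
    ; connected = λ a u v cu cv →
        Star.map (λ (e , cx , cy) → e , to cx , to cy) (connected a u v (from cu) (from cv))
    ; edges = λ a b a∈ b∈ ab → let u , v , e , cu , cv = edges a b a∈ b∈ ab in u , v , e , to cu , to cv
    }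
    where
    open IsModel M
    to : ∀ {v a} → v ∈ V × f v ≡ a → v ∈ V × g v ≡ a
    to {v} (v∈ , fv) = v∈ , trans (≡-sym (f≗g v)) fv
    from : ∀ {v a} → v ∈ V × g v ≡ a → v ∈ V × f v ≡ a
    from {v} (v∈ , gv) = v∈ , trans (f≗g v) gv

  isModel? : ∀ L A V f → Dec (IsModel L A V f)
  isModel? L A V f = map′
    (λ (i , l , o , c , e) → record
      { inA = λ {v} → i v ; label = λ {v} → l v ; onto = o ; connected = c ; edges = e })
    (λ M → let open IsModel M in (λ v → inA {v}) , (λ v → label {v}) , onto , connected , edges)
    ( all? (λ v → (v ∈? V) →-dec (v ∈? A))
    ×-dec all? (λ v → (v ∈? V) →-dec (f v ∈? L))
    ×-dec all? (λ a → (a ∈? L) →-dec any? (λ v → class? a v))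
    ×-dec all? (λ a → all? λ u → all? λ v →
            class? a u →-dec (class? a v →-dec star? (classEdge? a) u v))
    ×-dec all? (λ a → all? λ b → (a ∈? L) →-dec ((b ∈? L) →-dec (adj? T a b →-dec
            any? (λ u → any? λ v → adj? G u v ×-dec (class? a u ×-dec class? b v))))))
    where
    class? : ∀ a v → Dec (v ∈ V × f v ≡ a)
    class? a v = (v ∈? V) ×-dec (f v ≟ a)
    classEdge? : ∀ a → B.Decidable (ClassEdge V f a)
    classEdge? a x y = adj? G x y ×-dec (class? a x ×-dec class? a y)

  minor? : Decidable Minor
  minor? A = map′
    (λ (V , c , M) → V , finToFun c , M)
    (λ (V , f , M) → V , funToFin f , model-cong (λ v → ≡-sym (finToFun-funToFin f v)) M)
    (anySubset? λ V → any? λ c → isModel? full A V (finToFun c))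

  fromMinorModel : ∀ {A} → HasMinorWithin T G A → Minor A
  fromMinorModel M = VS , f , record
    { inA = λ {v} → VS⊆P v
    ; label = λ _ → ∈⊤
    ; onto = λ a _ → onto a
    ; connected = λ { _ u v (u∈ , refl) (v∈ , fv) →
        Star.map (λ {x} {y} (e , fx , fy) → let xy , x∈ , y∈ = ES⊆E x y e in xy , (x∈ , fx) , (y∈ , fy))
          (classConnected u v u∈ v∈ (≡-sym fv)) }
    ; edges = λ a b _ _ ab →
        let u , v , e , fu , fv = edges→ a b (λ { refl → case trans (≡-sym ab) (irrefl T a) of λ () }) ab
            uv , u∈ , v∈ = ES⊆E u v e
        in u , v , uv , (u∈ , fu) , (v∈ , fv)
    }
    where open MinorModel M

  toMinorModel : ∀ {A} → Minor A → HasMinorWithin T G A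
  toMinorModel (V , f , M) = record
    { VS = V
    ; VS⊆P = λ v → inA
    ; ES = λ u v → does (edge? u v)
    ; ES-sym = λ u v e → dec-true (edge? v u) (edge-sym (does-true (edge? u v) e))
    ; ES⊆E = λ u v e → let uv , u∈ , v∈ , _ = does-true (edge? u v) e in uv , u∈ , v∈
    ; f = f
    ; onto = λ a → onto a ∈⊤
    ; classConnected = λ u v u∈ v∈ fu≡fv →
        Star.map (λ {x} {y} (xy , (x∈ , fx) , (y∈ , fy)) →
            dec-true (edge? x y) (xy , x∈ , y∈ , inj₁ (trans fx (≡-sym fy))) , fx , fy)
          (connected (f u) u v (u∈ , refl) (v∈ , ≡-sym fu≡fv))
    ; edges→ = λ { _ _ _ ab → case edges _ _ ∈⊤ ∈⊤ ab of λ
        { (u , v , uv , (u∈ , refl) , (v∈ , refl)) →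
          u , v , dec-true (edge? u v) (uv , u∈ , v∈ , inj₂ ab) , refl , refl } }
    ; edges← = λ u v e fu≢fv → case does-true (edge? u v) e of λ
        { (_ , _ , _ , inj₁ fu≡fv) → contradiction fu≡fv fu≢fv
        ; (_ , _ , _ , inj₂ ab) → ab }
    }
    where
    open IsModel M
    -- Edges of `G` between branch sets of non-adjacent vertices of `T` are dropped, as `edges←`
    -- demands.
    Edge : B.Rel (Fin n) 0ℓ
    Edge u v = Adj G u v × u ∈ V × v ∈ V × (f u ≡ f v ⊎ Adj T (f u) (f v))
    edge? : B.Decidable Edge
    edge? u v = adj? G u v ×-dec ((u ∈? V) ×-dec ((v ∈? V) ×-dec ((f u ≟ f v) ⊎-dec adj? T (f u) (f v))))
    edge-sym : ∀ {u v} → Edge u v → Edge v u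
    edge-sym {u} {v} (uv , u∈ , v∈ , s) =
      sym G u v uv , v∈ , u∈ , [ inj₁ ∘ ≡-sym , inj₂ ∘ sym T (f u) (f v) ]′ s

  -- The vertex y joins the branch set of h, which is either new (h ∉ L) or contains a neighbour of y.
  module Extend {L L' : Subset t} {A V f} (M : IsModel L A V f)
    (y : Fin n) (y∉A : y ∉ A) (h : Fin t)
    (L⊆L' : L ⊆ L') (h∈L' : h ∈ L') (L'⊆ : ∀ {a} → a ∈ L' → a ∈ L ⊎ a ≡ h)
    (attach : h ∈ L → ∃ λ w → Adj G w y × w ∈ V × f w ≡ h)
    (join : h ∉ L → ∀ a → a ∈ L → Adj T a h → ∃ λ u → Adj G u y × u ∈ V × f u ≡ a) where

    open IsModel M

    V' : Subset n
    V' = V ∪ ⁅ y ⁆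

    f' : Fin n → Fin t
    f' z with z ≟ y
    ... | yes _ = h
    ... | no  _ = f z

    f'y : f' y ≡ h
    f'y with y ≟ y
    ... | yes _ = refl
    ... | no y≢y = contradiction refl y≢y

    f'-old : ∀ {z} → z ∈ V → f' z ≡ f z
    f'-old {z} z∈ with z ≟ y
    ... | yes refl = contradiction (inA z∈) y∉A
    ... | no _ = refl

    old : ∀ {z a} → z ∈ V × f z ≡ a → z ∈ V' × f' z ≡ a
    old (z∈ , fz) = ∪⁅⁆⁺ˡ z∈ , trans (f'-old z∈) fz

    new : y ∈ V' × f' y ≡ h
    new = ∪⁅⁆⁺ʳ y , f'y

    split : ∀ {z a} → z ∈ V' × f' z ≡ a → (z ∈ V × f z ≡ a) ⊎ (z ≡ y × a ≡ h)
    split (z∈ , f'z) with ∪⁅⁆⁻ V z∈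
    ... | inj₁ z∈V = inj₁ (z∈V , trans (≡-sym (f'-old z∈V)) f'z)
    ... | inj₂ refl = inj₂ (refl , trans (≡-sym f'z) f'y)

    lift : ∀ {a u v} → Star (ClassEdge V f a) u v → Star (ClassEdge V' f' a) u v
    lift = Star.map λ (xy , cx , cy) → xy , old cx , old cy

    label-of : ∀ {v a} → v ∈ V × f v ≡ a → a ∈ L
    label-of (v∈ , refl) = label v∈

    connected' : ∀ a u v → u ∈ V' × f' u ≡ a → v ∈ V' × f' v ≡ a → Star (ClassEdge V' f' a) u v
    connected' a u v cu cv with split cu | split cv
    ... | inj₁ cu₁ | inj₁ cv₁ = lift (connected a u v cu₁ cv₁)
    ... | inj₂ (refl , refl) | inj₂ (refl , _) = ε
    ... | inj₁ cu₁ | inj₂ (refl , refl) =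
      let w , wy , cw = attach (label-of cu₁)
      in lift (connected a u w cu₁ cw) ◅◅ ((wy , old cw , new) ◅ ε)
    ... | inj₂ (refl , refl) | inj₁ cv₁ =
      let w , wy , cw = attach (label-of cv₁)
      in (sym G w y wy , new , old cw) ◅ lift (connected a w v cw cv₁)

    edges' : ∀ a b → a ∈ L' → b ∈ L' → Adj T a b →
      ∃ λ u → ∃ λ v → Adj G u v × (u ∈ V' × f' u ≡ a) × (v ∈ V' × f' v ≡ b)
    edges' a b a∈ b∈ ab with a ∈? L | b ∈? L
    ... | yes a∈L | yes b∈L = let u , v , uv , cu , cv = edges a b a∈L b∈L ab in u , v , uv , old cu , old cv
    -- The only vertex of `L'` that can lie outside `L` is `h`, so `b` is `h` and `join` provides
    -- the edge.
    ... | yes a∈L | no b∉L with refl ← [ (λ b∈L → contradiction b∈L b∉L) , id ]′ (L'⊆ b∈) =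
      let u , uy , cu = join b∉L a a∈L ab in u , y , uy , old cu , new
    ... | no a∉L | yes b∈L with refl ← [ (λ a∈L → contradiction a∈L a∉L) , id ]′ (L'⊆ a∈) =
      let u , uy , cu = join a∉L b b∈L (sym T a b ab) in y , u , sym G u y uy , new , old cu
    ... | no a∉L | no b∉L
      with refl ← [ (λ a∈L → contradiction a∈L a∉L) , id ]′ (L'⊆ a∈)
         | refl ← [ (λ b∈L → contradiction b∈L b∉L) , id ]′ (L'⊆ b∈) =
      case trans (≡-sym ab) (irrefl T a) of λ ()

    model : IsModel L' (A ∪ ⁅ y ⁆) V' f'
    model = record
      { inA = λ z∈ → [ ∪⁅⁆⁺ˡ ∘ inA , (λ { refl → ∪⁅⁆⁺ʳ y }) ]′ (∪⁅⁆⁻ V z∈)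
      ; label = λ {z} z∈ → case split (z∈ , refl) of λ
          { (inj₁ cz) → L⊆L' (label-of cz)
          ; (inj₂ (_ , f'z≡h)) → subst (_∈ L') (≡-sym f'z≡h) h∈L' }
      ; onto = λ a a∈ → case L'⊆ a∈ of λ
          { (inj₁ a∈L) → let v , cv = onto a a∈L in v , old cv
          ; (inj₂ refl) → y , new }
      ; connected = connected'
      ; edges = edges'
      }

  -- Boundaries of vertex sets

  -- Directed arcs instead of edges: the proof of Menger's theorem deletes them one at a time, and
  -- `Separation` restricts their heads. Each arc still comes from an edge of `G`, so a model may be
  -- extended along it.
  record Arcs : Set₁ where
    field
      Arc  : B.Rel (Fin n) 0ℓ
      arc? : B.Decidable Arc
      arc⇒adj : ∀ {u v} → Arc u v → Adj G u v
  open Arcs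

  deleteArc : Arcs → Fin n → Fin n → Arcs
  deleteArc D x y = record
    { Arc = λ u v → Arc D u v × ¬ (u ≡ x × v ≡ y)
    ; arc? = λ u v → arc? D u v ×-dec ¬? ((u ≟ x) ×-dec (v ≟ y))
    ; arc⇒adj = arc⇒adj D ∘ proj₁
    }

  Exits : Arcs → Subset n → Pred (Fin n) 0ℓ
  Exits D A v = v ∈ A × ∃ λ w → w ∉ A × Arc D v w

  exits? : ∀ D A → Decidable (Exits D A)
  exits? D A v = (v ∈? A) ×-dec any? (λ w → ¬? (w ∈? A) ×-dec arc? D v w)

  ∂ : Arcs → Subset n → Subset n
  ∂ D A = comprehension (exits? D A)

  ∂⁺ : ∀ D A {v} → Exits D A v → v ∈ ∂ D A
  ∂⁺ D A = ∈-comprehension⁺ (exits? D A)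

  ∂⁻ : ∀ D A {v} → v ∈ ∂ D A → Exits D A v
  ∂⁻ D A = ∈-comprehension⁻ (exits? D A)

  ∂-deleteArc : ∀ D x y A → ∂ (deleteArc D x y) A ⊆ ∂ D A
  ∂-deleteArc D x y A v∈ =
    let v∈A , w , w∉A , vw , _ = ∂⁻ (deleteArc D x y) A v∈ in ∂⁺ D A (v∈A , w , w∉A , vw)

  ∂-insert : ∀ D A y → ∂ D (A ∪ ⁅ y ⁆) ⊆ ∂ D A ∪ ⁅ y ⁆
  ∂-insert D A y v∈ with v∈A' , w , w∉ , vw ← ∂⁻ D (A ∪ ⁅ y ⁆) v∈ | ∪⁅⁆⁻ A v∈A'
  ... | inj₁ v∈A = ∪⁅⁆⁺ˡ (∂⁺ D A (v∈A , w , w∉ ∘ ∪⁅⁆⁺ˡ , vw))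
  ... | inj₂ refl = ∪⁅⁆⁺ʳ y

  -- Rooted models and their transport by Menger's theorem

  record Rooted (D : Arcs) (L : Subset t) (A : Subset n) : Set where
    field
      V : Subset n
      f : Fin n → Fin t
      isModel : IsModel L A V f
      root : ∀ a → a ∈ L → ∃ λ v → v ∈ ∂ D A × v ∈ V × f v ≡ a

  rooted-mono : ∀ {D D' L A B} → A ⊆ B → ∂ D A ⊆ ∂ D' B → Rooted D L A → Rooted D' L B
  rooted-mono A⊆B ∂⊆∂ R = record
    { V = V ; f = f ; isModel = model-mono A⊆B isModel
    ; root = λ a a∈ → let v , v∈∂ , c = root a a∈ in v , ∂⊆∂ v∈∂ , c }
    where open Rooted R

  -- If some boundary vertex w of Z stops being one, all its exits lead to y, so y can replace w as a root.
  rooted-insert : ∀ D {L} Z y → y ∉ Z → ∣ ∂ D Z ∣ ≤ ∣ ∂ D (Z ∪ ⁅ y ⁆) ∣ →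
    Rooted D L Z → Rooted D L (Z ∪ ⁅ y ⁆)
  rooted-insert D {L} Z y y∉Z ∂≤∂ R
    with any? (λ w → (w ∈? ∂ D Z) ×-dec ¬? (w ∈? ∂ D (Z ∪ ⁅ y ⁆)))
  ... | no none = rooted-mono ∪⁅⁆⁺ˡ
    (λ {w} w∈ → decidable-stable (w ∈? ∂ D (Z ∪ ⁅ y ⁆)) (λ w∉ → none (w , w∈ , w∉))) R
  ... | yes (w , w∈∂ , w∉∂') = go (w ∈? V)
    where
    open Rooted R
    Z' = Z ∪ ⁅ y ⁆
    ∂'⊆ : ∂ D Z' ⊆ (∂ D Z - w) ∪ ⁅ y ⁆
    ∂'⊆ {v} v∈ with ∪⁅⁆⁻ (∂ D Z) (∂-insert D Z y v∈)
    ... | inj₁ v∈∂ = ∪⁅⁆⁺ˡ (x∈p∧x≢y⇒x∈p-y v∈∂ (λ { refl → w∉∂' v∈ }))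
    ... | inj₂ refl = ∪⁅⁆⁺ʳ y
    -- Replacing `w` by `y` yields at most `∣ ∂ D Z ∣` vertices, hence at most as many as the new
    -- boundary has, so the inclusion `∂'⊆` is an equality.
    ⊆∂' : (∂ D Z - w) ∪ ⁅ y ⁆ ⊆ ∂ D Z'
    ⊆∂' = p⊆q∧∣q∣≤∣p∣⇒q⊆p ∂'⊆
      (≤-trans (∣p∪⁅y⁆∣≤1+∣p∣ (∂ D Z - w) y) (≤-trans (x∈p⇒∣p-x∣<∣p∣ w∈∂) ∂≤∂))
    keep : ∀ {v} → v ∈ ∂ D Z → v ≢ w → v ∈ ∂ D Z'
    keep v∈∂ v≢w = ⊆∂' (∪⁅⁆⁺ˡ (x∈p∧x≢y⇒x∈p-y v∈∂ v≢w))
    wy : Arc D w y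
    wy with w∈Z , z , z∉Z , wz ← ∂⁻ D Z w∈∂ | z ≟ y
    ... | yes refl = wz
    ... | no z≢y = contradiction
      (∂⁺ D Z' (∪⁅⁆⁺ˡ w∈Z , z , (λ z∈ → [ z∉Z , z≢y ]′ (∪⁅⁆⁻ Z z∈)) , wz)) w∉∂'
    go : Dec (w ∈ V) → Rooted D L Z'
    go (no w∉V) = record
      { V = V ; f = f ; isModel = model-mono ∪⁅⁆⁺ˡ isModel
      ; root = λ a a∈ → let v , v∈∂ , v∈V , fv = root a a∈ in
          v , keep v∈∂ (λ { refl → w∉V v∈V }) , v∈V , fv }
    -- Here `w` may be a root: `y` joins the branch set of `w` through the arc `wy` and takes over
    -- as its root.
    go (yes w∈V) = record { V = V' ; f = f' ; isModel = model ; root = root' }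
      where
      fw∈L = IsModel.label isModel w∈V
      open Extend isModel y y∉Z (f w) id fw∈L inj₁
        (λ _ → w , arc⇒adj D wy , w∈V , refl) (λ fw∉L → contradiction fw∈L fw∉L)
      root' : ∀ a → a ∈ L → ∃ λ v → v ∈ ∂ D Z' × v ∈ V' × f' v ≡ a
      root' a a∈ with v , v∈∂ , cv ← root a a∈ | v ≟ w
      ... | yes refl = y , ⊆∂' (∪⁅⁆⁺ʳ y) , proj₁ new , trans (proj₂ new) (proj₂ cv)
      ... | no v≢w = v , keep v∈∂ v≢w , old cv

  -- Göring's proof of Menger's theorem: delete an arc from A to B ─ A, and if this creates
  -- a separator Z that is too small, pass through Z and Z ∪ ⁅ y ⁆ instead.
  link-along : ∀ d (xys : List (Fin n × Fin n)) D {L} m A B →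
    A ⊆ B → ∣ ∂ D A ∣ ≤ m → ∣ ∂ D B ∣ ≤ m →
    (∀ Z → A ⊆ Z → Z ⊆ B → m ≤ ∣ ∂ D Z ∣) →
    ∣ B ∣ ≤ d + ∣ A ∣ →
    (∀ {x y} → Arc D x y → x ∈ A → y ∈ B → y ∉ A → (x , y) ∈ˡ xys) →
    Rooted D L A → Rooted D L B
  -- With no arc left from `A` to `B ─ A`, every arc leaving `A` also leaves `B`, so all roots stay
  -- on the boundary.
  link-along d [] D m A B A⊆B ∂A≤ ∂B≤ ≤∂Z bound listed = rooted-mono A⊆B ∂A⊆∂B
    where
    ∂A⊆∂B : ∂ D A ⊆ ∂ D B
    ∂A⊆∂B v∈ with v∈A , w , w∉A , vw ← ∂⁻ D A v∈ | w ∈? B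
    ... | no w∉B = ∂⁺ D B (A⊆B v∈A , w , w∉B , vw)
    ... | yes w∈B = case listed vw v∈A w∈B w∉A of λ ()
  link-along d ((x , y) ∷ xys) D m A B A⊆B ∂A≤ ∂B≤ ≤∂Z bound listed
    with arc? D x y ×-dec ((x ∈? A) ×-dec ((y ∈? B) ×-dec ¬? (y ∈? A)))
  ... | no ¬xy = link-along d xys D m A B A⊆B ∂A≤ ∂B≤ ≤∂Z bound
    λ uv u∈ v∈ v∉ → case listed uv u∈ v∈ v∉ of λ
      { (here refl) → contradiction (uv , u∈ , v∈ , v∉) ¬xy ; (there uv∈) → uv∈ }
  ... | yes (xy , x∈A , y∈B , y∉A)
    with anySubset? (λ Z → (A ⊆? Z) ×-dec ((Z ⊆? B) ×-dec (∣ ∂ (deleteArc D x y) Z ∣ <? m)))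
  ... | no none = rooted-mono id (∂-deleteArc D x y B) ∘
      link-along d xys D' m A B A⊆B
        (≤-trans (p⊆q⇒∣p∣≤∣q∣ (∂-deleteArc D x y A)) ∂A≤)
        (≤-trans (p⊆q⇒∣p∣≤∣q∣ (∂-deleteArc D x y B)) ∂B≤)
        ≤∂'Z bound
        (λ (uv , ≢xy) u∈ v∈ v∉ → case listed uv u∈ v∈ v∉ of λ
          { (here refl) → contradiction (refl , refl) ≢xy ; (there uv∈) → uv∈ })
      -- Deleting the arc can only shrink the boundary of `A`, but it had at most `m` vertices and
      -- still has at least `m`. So it is unchanged and keeps all roots.
      ∘ rooted-mono id
          (p⊆q∧∣q∣≤∣p∣⇒q⊆p (∂-deleteArc D x y A) (≤-trans ∂A≤ (≤∂'Z A id A⊆B)))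
    where
    D' = deleteArc D x y
    ≤∂'Z : ∀ Z → A ⊆ Z → Z ⊆ B → m ≤ ∣ ∂ D' Z ∣
    ≤∂'Z Z A⊆Z Z⊆B = ≮⇒≥ (λ ∂'Z< → none (Z , A⊆Z , Z⊆B , ∂'Z<))
  link-along zero (_ ∷ _) D m A B A⊆B ∂A≤ ∂B≤ ≤∂Z bound listed
    | yes (xy , x∈A , y∈B , y∉A) | yes _ = contradiction (p⊆q∧∣q∣≤∣p∣⇒q⊆p A⊆B bound y∈B) y∉A
  link-along (suc d) ((x , y) ∷ _) D m A B A⊆B ∂A≤ ∂B≤ ≤∂Z bound listed
    | yes (xy , x∈A , y∈B , y∉A) | yes (Z , A⊆Z , Z⊆B , ∂'Z<) =
      -- Read from the bottom: `A` to `Z`, `Z` to `Z'`, `Z'` to `B`, all along the undiminished `D`.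
      -- As `y` lies in `Z'` and `B` but not in `A` or `Z`, the gaps from `A` to `Z` and from `Z'`
      -- to `B` are smaller than that from `A` to `B`; this pays for resetting the list to all
      -- pairs.
      link-along d allPairs D m Z' B Z'⊆B ∂Z'≤ ∂B≤ (λ Y Z'⊆Y → ≤∂Z Y (Z'⊆Y ∘ A⊆Z'))
        (shift-bound d bound (p⊂q⇒∣p∣<∣q∣ (A⊆Z' , y , ∪⁅⁆⁺ʳ y , y∉A))) listedAll
    ∘ rooted-insert D Z y y∉Z (≤-trans ∂Z≤ (≤∂Z Z' A⊆Z' Z'⊆B))
    ∘ link-along d allPairs D m A Z A⊆Z ∂A≤ ∂Z≤ (λ Y A⊆Y Y⊆Z → ≤∂Z Y A⊆Y (Z⊆B ∘ Y⊆Z))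
        (s≤s⁻¹ (≤-trans (p⊂q⇒∣p∣<∣q∣ (Z⊆B , y , y∈B , y∉Z)) bound)) listedAll
    where
    D' = deleteArc D x y
    Z' = Z ∪ ⁅ y ⁆
    allPairs = cartesianProduct (allFin n) (allFin n)
    listedAll : ∀ {P Q R S : Set} {u v} → P → Q → R → S → (u , v) ∈ˡ allPairs
    listedAll {u = u} {v} _ _ _ _ = ∈-cartesianProduct⁺ (∈-allFin u) (∈-allFin v)
    -- If `y` were in `Z`, the deleted arc would not leave `Z`, and the boundary of `Z` would have
    -- kept its size of at least `m`.
    y∉Z : y ∉ Z
    y∉Z y∈Z = ≤⇒≯ (≤-trans (≤∂Z Z A⊆Z Z⊆B) (p⊆q⇒∣p∣≤∣q∣ ∂Z⊆∂'Z)) ∂'Z<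
      where
      ∂Z⊆∂'Z : ∂ D Z ⊆ ∂ D' Z
      ∂Z⊆∂'Z v∈ = let v∈Z , w , w∉Z , vw = ∂⁻ D Z v∈ in
        ∂⁺ D' Z (v∈Z , w , w∉Z , vw , λ { (_ , refl) → w∉Z y∈Z })
    A⊆Z' : A ⊆ Z'
    A⊆Z' = ∪⁅⁆⁺ˡ ∘ A⊆Z
    Z'⊆B : Z' ⊆ B
    Z'⊆B z∈ = [ Z⊆B , (λ { refl → y∈B }) ]′ (∪⁅⁆⁻ Z z∈)
    -- Restoring the arc adds at most its tail `x` to a boundary of fewer than `m` vertices.
    ∂Z≤ : ∣ ∂ D Z ∣ ≤ m
    ∂Z≤ = ≤-trans (p⊆q⇒∣p∣≤∣q∣ ∂Z⊆) (≤-trans (∣p∪⁅y⁆∣≤1+∣p∣ (∂ D' Z) x) ∂'Z<)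
      where
      ∂Z⊆ : ∂ D Z ⊆ ∂ D' Z ∪ ⁅ x ⁆
      ∂Z⊆ {v} v∈ with v∈Z , w , w∉Z , vw ← ∂⁻ D Z v∈ | v ≟ x
      ... | yes refl = ∪⁅⁆⁺ʳ x
      ... | no v≢x = ∪⁅⁆⁺ˡ (∂⁺ D' Z (v∈Z , w , w∉Z , vw , v≢x ∘ proj₁))
    -- The restored arc ends inside `Z'`, so here only `y` can be added.
    ∂Z'≤ : ∣ ∂ D Z' ∣ ≤ m
    ∂Z'≤ = ≤-trans (p⊆q⇒∣p∣≤∣q∣ ∂Z'⊆) (≤-trans (∣p∪⁅y⁆∣≤1+∣p∣ (∂ D' Z) y) ∂'Z<)
      where
      ∂Z'⊆ : ∂ D Z' ⊆ ∂ D' Z ∪ ⁅ y ⁆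
      ∂Z'⊆ v∈ with v∈Z' , w , w∉Z' , vw ← ∂⁻ D Z' v∈ | ∪⁅⁆⁻ Z v∈Z'
      ... | inj₁ v∈Z = ∪⁅⁆⁺ˡ (∂⁺ D' Z (v∈Z , w , w∉Z' ∘ ∪⁅⁆⁺ˡ , vw , λ { (_ , refl) → w∉Z' (∪⁅⁆⁺ʳ y) }))
      ... | inj₂ refl = ∪⁅⁆⁺ʳ y

  link : ∀ D {L} m A B → A ⊆ B → ∣ ∂ D A ∣ ≤ m → ∣ ∂ D B ∣ ≤ m →
    (∀ Z → A ⊆ Z → Z ⊆ B → m ≤ ∣ ∂ D Z ∣) → Rooted D L A → Rooted D L B
  link D m A B A⊆B ∂A≤ ∂B≤ ≤∂Z =
    link-along ∣ B ∣ (cartesianProduct (allFin n) (allFin n)) D m A B A⊆B ∂A≤ ∂B≤ ≤∂Z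
      (m≤m+n ∣ B ∣ ∣ A ∣) (λ {x} {y} _ _ _ _ → ∈-cartesianProduct⁺ (∈-allFin x) (∈-allFin y))

-- Finding the separator inside `W`

module Separation {t n : ℕ} (T : Graph (suc t)) (tree : IsTree T) (G : Graph n) (W : Subset n) where

  open Models T G

  -- With heads restricted to `W`, `bd A` is the boundary of `A ⊆ W` within `G[W]`.
  arcs : Arcs
  arcs = record
    { Arc = λ u v → Adj G u v × v ∈ W
    ; arc? = λ u v → adj? G u v ×-dec (v ∈? W)
    ; arc⇒adj = proj₁ }

  bd : Subset n → Subset n
  bd = ∂ arcs

  record Admissible (i : ℕ) (A : Subset n) : Set where
    constructor admissible
    field
      ⊆W : A ⊆ W
      bd≤ : ∣ bd A ∣ ≤ i
      interior : ¬ Minor (A ─ bd A)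

  admissible? : ∀ i → Decidable (Admissible i)
  admissible? i A = map′
    (λ (p , q , r) → admissible (λ {x} → p x) q r)
    (λ (admissible p q r) → (λ x → p {x}) , q , r)
    (all? (λ x → (x ∈? A) →-dec (x ∈? W)) ×-dec ((∣ bd A ∣ ≤? i) ×-dec ¬? (minor? (A ─ bd A))))

  Maximal : ℕ → Subset n → Set
  Maximal i A = ∀ Z → A ⊆ Z → Admissible i Z → Z ⊆ A

  record Separator : Set where
    field
      A S : Subset n
      A⊆W : A ⊆ W
      ∣S∣≤ : ∣ S ∣ ≤ suc t
      minorA : Minor A
      ¬minorA─S : ¬ Minor (A ─ S)
      separated : ∀ u v → u ∈ A → u ∉ S → v ∈ W → v ∉ A → ¬ Adj G u v

  -- An arc that starts in `Z` and leaves `B` also leaves `Z`. Thus every set below an admissible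
  -- one inherits a minor-free interior.
  interior-mono : ∀ {Z B} → Z ⊆ B → Z ─ bd Z ⊆ B ─ bd B
  interior-mono {Z} {B} Z⊆B v∈ = x∈p∧x∉q⇒x∈p─q (Z⊆B v∈Z) λ v∈∂B →
    let _ , w , w∉B , vw = ∂⁻ arcs B v∈∂B
    in x∈p─q⇒x∉q Z (bd Z) v∈ (∂⁺ arcs Z (v∈Z , w , w∉B ∘ Z⊆B , vw))
    where v∈Z = p─q⊆p Z (bd Z) v∈

  bd-separates : ∀ {A} u v → u ∈ A → u ∉ bd A → v ∈ W → v ∉ A → ¬ Adj G u v
  bd-separates {A} u v u∈ u∉ v∈W v∉A uv = u∉ (∂⁺ arcs A (u∈ , v , v∉A , uv , v∈W))

  -- If `A` contained all of `W`, no arc would leave it, and its interior would contain the minor of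
  -- `W`.
  outside-vertex : ∀ {A} → Minor W → ¬ Minor (A ─ bd A) → ∃ λ y → y ∈ W × y ∉ A
  outside-vertex {A} minorW ¬minor with any? (λ y → (y ∈? W) ×-dec ¬? (y ∈? A))
  ... | yes found = found
  ... | no none = contradiction (minor-mono W⊆ minorW) ¬minor
    where
    W⊆A : W ⊆ A
    W⊆A {x} x∈ = decidable-stable (x ∈? A) (λ x∉ → none (x , x∈ , x∉))
    W⊆ : W ⊆ A ─ bd A
    W⊆ x∈ = x∈p∧x∉q⇒x∈p─q (W⊆A x∈) λ x∈∂ →
      let _ , w , w∉A , _ , w∈W = ∂⁻ arcs A x∈∂ in w∉A (W⊆A w∈W)

  record Extension {L A} (R : Rooted arcs L A) : Set where
    open Rooted R
    field
      h : Fin (suc t)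
      y : Fin n
      h∉L : h ∉ L
      y∈W : y ∈ W
      y∉A : y ∉ A
      conn' : InducedConnected T (L ∪ ⁅ h ⁆)
      join : ∀ a → a ∈ L → Adj T a h → ∃ λ u → Adj G u y × u ∈ V × f u ≡ a

  -- For nonempty `L`, a path of `T` towards `h₀` leaves `L` by an edge `ah`, and `y` is an outer
  -- neighbour of the root of `a`. By acyclicity `a` is the only neighbour of `h` in `L`, so this
  -- one edge suffices. For empty `L`, any `y` in `W` outside `A` will do.
  extension : ∀ {L A h₀} → Minor W → ¬ Minor (A ─ bd A) → InducedConnected T L → h₀ ∉ L →
    (R : Rooted arcs L A) → Extension R
  extension {L} {A} {h₀} minorW ¬minor conn h₀∉ R with nonempty? L
  ... | no empty = let y , y∈W , y∉A = outside-vertex minorW ¬minor in record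
    { h = h₀ ; y = y ; h∉L = h₀∉ ; y∈W = y∈W ; y∉A = y∉A
    ; conn' = induced-insert T conn (λ a∈ → contradiction (_ , a∈) empty)
    ; join = λ a a∈ → contradiction (a , a∈) empty }
  ... | yes (a₀ , a₀∈) =
    let a , h , a∈ , h∉ , ah = exit-edge T (proj₁ tree a₀ h₀) a₀∈ h₀∉
        x , x∈∂ , cx = root a a∈
        _ , y , y∉A , xy , y∈W = ∂⁻ arcs A x∈∂
    in record
    { h = h ; y = y ; h∉L = h∉ ; y∈W = y∈W ; y∉A = y∉A
    ; conn' = induced-insert T conn (λ _ → a , a∈ , ah)
    ; join = λ b b∈ bh → case unique-neighbour T (proj₂ tree) conn h∉ a∈ b∈ ah bh of λ
        { refl → x , xy , cx } }
    where open Rooted R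

  -- `r` bounds the remaining rounds. Through `i ≤ ∣ L ∣` the boundary bound `i` stays at most
  -- `suc t`, and below it while some vertex of `T` is missing; this leaves room for `y` in the
  -- separator.
  grow : ∀ r i L A → suc t ≤ r + i → i ≤ ∣ L ∣ → Minor W → InducedConnected T L →
    Admissible i A → Maximal i A → Rooted arcs L A → Separator
  grow r i L A bound i≤ minorW conn adm max R with all? (_∈? L)
  grow r i L A bound i≤ minorW conn adm max R | yes all∈ = record
    { A = A ; S = bd A ; A⊆W = ⊆W ; ∣S∣≤ = ≤-trans bd≤ (≤-trans i≤ (∣p∣≤n L))
    ; minorA = V , f , subst (λ K → IsModel K A V f) (⊆-antisym ⊆⊤ (λ {a} _ → all∈ a)) isModel
    ; ¬minorA─S = interior
    ; separated = bd-separates }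
    where
    open Rooted R
    open Admissible adm
  grow r i L A bound i≤ minorW conn adm max R | no ¬all
    with h₀ , h₀∉ ← ¬∀⟶∃¬ (suc t) (_∈ L) (_∈? L) ¬all = proceed r bound
    where
    open Rooted R
    open Admissible adm
    open Extension (extension minorW interior conn h₀∉ R)
    i<t : i < suc t
    i<t = ≤-<-trans i≤ (<-≤-trans (p⊂q⇒∣p∣<∣q∣ (p⊂p∪⁅y⁆ h∉L)) (∣p∣≤n (L ∪ ⁅ h ⁆)))
    L' = L ∪ ⁅ h ⁆
    A' = A ∪ ⁅ y ⁆
    S = bd A ∪ ⁅ y ⁆
    ∣S∣≤1+i : ∣ S ∣ ≤ suc i
    ∣S∣≤1+i = ≤-trans (∣p∪⁅y⁆∣≤1+∣p∣ (bd A) y) (s≤s bd≤)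
    A'⊆W : A' ⊆ W
    A'⊆W x∈ = [ ⊆W , (λ { refl → y∈W }) ]′ (∪⁅⁆⁻ A x∈)
    strip : ∀ {u} → u ∈ A' → u ∉ S → u ∈ A × u ∉ bd A
    strip u∈ u∉ = [ id , (λ { refl → contradiction (∪⁅⁆⁺ʳ y) u∉ }) ]′ (∪⁅⁆⁻ A u∈) , u∉ ∘ ∪⁅⁆⁺ˡ
    stop-here : Minor A' → Separator
    stop-here minorA' = record
      { A = A' ; S = S ; A⊆W = A'⊆W ; ∣S∣≤ = ≤-trans ∣S∣≤1+i i<t
      ; minorA = minorA'
      ; ¬minorA─S = interior ∘ minor-mono (λ u∈ →
          let u∈A , u∉ = strip (p─q⊆p A' S u∈) (x∈p─q⇒x∉q A' S u∈) in x∈p∧x∉q⇒x∈p─q u∈A u∉)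
      ; separated = λ u v u∈ u∉ v∈W v∉ →
          let u∈A , u∉∂ = strip u∈ u∉ in bd-separates u v u∈A u∉∂ v∈W (v∉ ∘ ∪⁅⁆⁺ˡ) }
    -- A smaller boundary would make `Z` admissible for `i`, and maximality of `A` would put `y`
    -- into `A`.
    large : ∀ {Z} → A' ⊆ Z → Z ⊆ W → ¬ Minor (Z ─ bd Z) → suc i ≤ ∣ bd Z ∣
    large {Z} A'⊆Z Z⊆W int = ≰⇒> λ bd≤i →
      y∉A (max Z (A'⊆Z ∘ ∪⁅⁆⁺ˡ) (admissible Z⊆W bd≤i int) (A'⊆Z (∪⁅⁆⁺ʳ y)))
    proceed : ∀ r → suc t ≤ r + i → Separator
    proceed r bound with minor? A'
    proceed r bound | yes minorA' = stop-here minorA'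
    proceed zero bound | no _ = contradiction i<t (≤⇒≯ bound)
    proceed (suc r) bound | no ¬minorA'
      -- `A'` has no minor, hence neither has its interior, and its boundary lies in `S`; so it is
      -- admissible for `suc i`.
      with B , A'⊆B , admB , maxB ← maximalSuperset (admissible? (suc i))
             (admissible A'⊆W (≤-trans (p⊆q⇒∣p∣≤∣q∣ (∂-insert arcs A y)) ∣S∣≤1+i)
               (¬minorA' ∘ minor-mono (p─q⊆p A' (bd A')))) =
      grow r (suc i) L' B (shift-bound r bound ≤-refl)
        (≤-<-trans i≤ (p⊂q⇒∣p∣<∣q∣ (p⊂p∪⁅y⁆ h∉L))) minorW conn' admB maxB
        (link arcs (suc i) A' B A'⊆B (≤-trans (p⊆q⇒∣p∣≤∣q∣ (∂-insert arcs A y)) ∣S∣≤1+i)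
          (Admissible.bd≤ admB)
          (λ Z A'⊆Z Z⊆B → large A'⊆Z (Admissible.⊆W admB ∘ Z⊆B)
            (Admissible.interior admB ∘ minor-mono (interior-mono Z⊆B)))
          R')
      where
      open Extend isModel y y∉A h ∪⁅⁆⁺ˡ (∪⁅⁆⁺ʳ h) (∪⁅⁆⁻ L)
        (λ h∈ → contradiction h∈ h∉L) (λ _ → join)
      -- By `large` the boundary of `A'` has at least `suc i` vertices, and it lies in `S`, which
      -- has at most that many. So the old roots and `y` are all on it.
      S⊆bdA' : S ⊆ bd A'
      S⊆bdA' = p⊆q∧∣q∣≤∣p∣⇒q⊆p (∂-insert arcs A y)
        (≤-trans ∣S∣≤1+i (large id A'⊆W (¬minorA' ∘ minor-mono (p─q⊆p A' (bd A')))))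
      root' : ∀ a → a ∈ L' → ∃ λ v → v ∈ bd A' × v ∈ V' × f' v ≡ a
      root' a a∈ with ∪⁅⁆⁻ L a∈
      ... | inj₁ a∈L = let v , v∈∂ , cv = root a a∈L in v , S⊆bdA' (∪⁅⁆⁺ˡ v∈∂) , old cv
      ... | inj₂ refl = y , S⊆bdA' (∪⁅⁆⁺ʳ y) , new
      R' : Rooted arcs L' A'
      R' = record { V = V' ; f = f' ; isModel = model ; root = root' }

  -- The start is the empty model with a maximal set of empty boundary; `∅` is admissible because
  -- `T` has a vertex.
  separator : Minor W → Separator
  separator minorW
    with A , _ , admA , maxA ← maximalSuperset (admissible? 0) {∅} (admissible ⊥⊆
           (≤-trans (p⊆q⇒∣p∣≤∣q∣ (λ v∈ → proj₁ (∂⁻ arcs ∅ v∈))) (≤-reflexive (∣⊥∣≡0 n)))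
           (λ (V , f , M) → let v , v∈ , _ = IsModel.onto M zero ∈⊤ in
             ∉⊥ (p─q⊆p ∅ (bd ∅) (IsModel.inA M v∈)))) =
    grow (suc t) 0 ∅ A (m≤m+n (suc t) 0) z≤n minorW (λ a∈ → contradiction a∈ ∉⊥) admA maxA record
      { V = ∅ ; f = λ _ → zero
      ; isModel = record
        { inA = λ v∈ → contradiction v∈ ∉⊥
        ; label = λ v∈ → contradiction v∈ ∉⊥
        ; onto = λ _ a∈ → contradiction a∈ ∉⊥
        ; connected = λ _ _ _ (u∈ , _) → contradiction u∈ ∉⊥
        ; edges = λ _ _ a∈ → contradiction a∈ ∉⊥ }
      ; root = λ _ a∈ → contradiction a∈ ∉⊥ }

-- Induction on the number of disjoint minors

module PackingOrCover {t n : ℕ} (T : Graph (suc t)) (tree : IsTree T) (G : Graph n) where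

  open Models T G

  -- A model of a connected graph is connected: `C` spreads within each branch set and follows a
  -- path of `T` from one branch set to the next.
  model-closed : ∀ {A V f} → IsModel full A V f → ∀ (C : Pred (Fin n) 0ℓ) →
    (∀ {u v} → u ∈ V → v ∈ V → Adj G u v → C u → C v) →
    ∀ {u v} → u ∈ V → C u → v ∈ V → C v
  model-closed {V = V} {f} M C closed {u} {v} u∈ cu v∈ = along (proj₁ tree (f u) (f v)) u∈ refl cu v∈ refl
    where
    open IsModel M
    inClass : ∀ {a x y} → Star (ClassEdge V f a) x y → C x → C y
    inClass ε cx = cx
    inClass ((xy , (x∈ , _) , (y∈ , _)) ◅ s) cx = inClass s (closed x∈ y∈ xy cx)
    along : ∀ {a b x y} → Star (Adj T) a b → x ∈ V → f x ≡ a → C x → y ∈ V → f y ≡ b → C y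
    along ε x∈ fx cx y∈ fy = inClass (connected _ _ _ (x∈ , fx) (y∈ , fy)) cx
    along (ac ◅ s) x∈ fx cx y∈ fy =
      let p , q , pq , (p∈ , fp) , (q∈ , fq) = edges _ _ ∈⊤ ∈⊤ ac
      in along s q∈ fq (closed p∈ q∈ pq (inClass (connected _ _ _ (x∈ , fx) (p∈ , fp)) cx)) y∈ fy

  Packing : ℕ → Subset n → Set
  Packing k W = Σ (Fin k → Subset n) λ S →
    PairwiseDisjoint S × (∀ i → S i ⊆ W) × (∀ i → Minor (S i))

  Cover : ℕ → Subset n → Set
  Cover b W = Σ (Subset n) λ X → ∣ X ∣ ≤ b × ¬ Minor (W ─ X)

  combine : ∀ j W (sep : Separation.Separator T tree G W) →
    let open Separation.Separator sep in
    Packing (suc j) (W ─ A) ⊎ Cover (suc t * j) (W ─ A) →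
    Packing (suc (suc j)) W ⊎ Cover (suc t * suc j) W
  combine j W sep (inj₁ (P , disjoint , P⊆ , minors)) = inj₁ (P' , disjoint' , P'⊆ , minors')
    where
    open Separation.Separator sep
    P' : Fin (suc (suc j)) → Subset n
    P' zero = A
    P' (suc i) = P i
    disjoint' : PairwiseDisjoint P'
    disjoint' zero zero i≢i = contradiction refl i≢i
    disjoint' zero (suc i) _ v v∈A v∈P = x∈p─q⇒x∉q W A (P⊆ i v∈P) v∈A
    disjoint' (suc i) zero _ v v∈P v∈A = x∈p─q⇒x∉q W A (P⊆ i v∈P) v∈A
    disjoint' (suc i) (suc k) i≢k = disjoint i k (i≢k ∘ cong suc)
    P'⊆ : ∀ i → P' i ⊆ W
    P'⊆ zero = A⊆W
    P'⊆ (suc i) = p─q⊆p W A ∘ P⊆ i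
    minors' : ∀ i → Minor (P' i)
    minors' zero = minorA
    minors' (suc i) = minors i
  combine j W sep (inj₂ (X , ∣X∣≤ , ¬minor)) = inj₂ (S ∪ X , bound , ¬minor')
    where
    open Separation.Separator sep
    bound : ∣ S ∪ X ∣ ≤ suc t * suc j
    bound = ≤-trans (∣p∪q∣≤∣p∣+∣q∣ S X)
      (≤-trans (+-mono-≤ ∣S∣≤ ∣X∣≤) (≤-reflexive (≡-sym (*-suc (suc t) j))))
    ¬minor' : ¬ Minor (W ─ (S ∪ X))
    -- The side of `A` on which a single vertex `v₀` lies decides the side of the whole model.
    ¬minor' (V , f , M) = case onto zero ∈⊤ of λ (v₀ , v₀∈ , _) → case v₀ ∈? A of λ
      { (yes v₀∈A) → ¬minorA─S (V , f , flip model-within M λ v∈ →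
          x∈p∧x∉q⇒x∈p─q (model-closed M (_∈ A) closedA v₀∈ v₀∈A v∈) (∉S v∈))
      ; (no v₀∉A) → ¬minor (V , f , flip model-within M λ v∈ →
          x∈p∧x∉q⇒x∈p─q
            (x∈p∧x∉q⇒x∈p─q (∈W v∈) (model-closed M (_∉ A) closed∁A v₀∈ v₀∉A v∈)) (∉X v∈)) }
      where
      open IsModel M
      ∈W : V ⊆ W
      ∈W v∈ = p─q⊆p W (S ∪ X) (inA v∈)
      ∉S : ∀ {v} → v ∈ V → v ∉ S
      ∉S v∈ = x∈p─q⇒x∉q W (S ∪ X) (inA v∈) ∘ x∈p∪q⁺ ∘ inj₁
      ∉X : ∀ {v} → v ∈ V → v ∉ X
      ∉X v∈ = x∈p─q⇒x∉q W (S ∪ X) (inA v∈) ∘ x∈p∪q⁺ ∘ inj₂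
      closedA : ∀ {u v} → u ∈ V → v ∈ V → Adj G u v → u ∈ A → v ∈ A
      closedA {u} {v} u∈ v∈ uv u∈A = decidable-stable (v ∈? A) λ v∉A →
        separated u v u∈A (∉S u∈) (∈W v∈) v∉A uv
      closed∁A : ∀ {u v} → u ∈ V → v ∈ V → Adj G u v → u ∉ A → v ∉ A
      closed∁A {u} {v} u∈ v∈ uv u∉A v∈A =
        separated v u v∈A (∉S v∈) (∈W u∈) u∉A (sym G u v uv)

  -- `j` is `k ∸ 1`: the last set of a packing is `W` itself and costs nothing, while each earlier
  -- one adds at most `suc t` vertices to the cover.
  packing-or-cover : ∀ j W → Packing (suc j) W ⊎ Cover (suc t * j) W
  packing-or-cover j W with minor? W
  packing-or-cover j W | no ¬minorW =
    inj₂ (∅ , ≤-trans (≤-reflexive (∣⊥∣≡0 n)) z≤n , ¬minorW ∘ minor-mono (p─q⊆p W ∅))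
  packing-or-cover zero W | yes minorW =
    inj₁ ((λ _ → W) , (λ { zero zero i≢i → contradiction refl i≢i }) , (λ _ → id) , λ _ → minorW)
  packing-or-cover (suc j) W | yes minorW =
    let sep = Separation.separator T tree G W minorW
    in combine j W sep (packing-or-cover j (W ─ Separation.Separator.A sep))

theorem1 : ∀ (t : ℕ) (T : Graph t) → IsTree T →
    ∀ (k : ℕ) → 1 ≤ k →
    ∀ (n : ℕ) (G : Graph n) →
    (Σ (Fin k → Subset n) λ S →
    PairwiseDisjoint S × (∀ i → HasMinorWithin T G (S i)))
    ⊎ (Σ (Subset n) λ X →
    ∣ X ∣ ≤ t * (k ∸ 1) × ¬ HasMinorWithin T G (∁ X))
-- IsTree allows the graph on no vertices; it is a minor of G only if G has no vertices.
theorem1 zero T tree k 1≤k n G with Models.minor? T G (∁ ∅)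
... | yes M = inj₁ ((λ _ → ∁ ∅) , (λ _ _ _ v _ _ → case proj₁ (proj₂ M) v of λ ()) , λ _ → toMinorModel M)
  where open Models T G
... | no ¬M = inj₂ (∅ , ≤-reflexive (∣⊥∣≡0 n) , ¬M ∘ Models.fromMinorModel T G)
theorem1 (suc t) T tree (suc j) 1≤k n G with PackingOrCover.packing-or-cover T tree G j full
... | inj₁ (S , disjoint , _ , minors) = inj₁ (S , disjoint , toMinorModel ∘ minors)
  where open Models T G
... | inj₂ (X , ∣X∣≤ , ¬minor) = inj₂ (X , ∣X∣≤ , λ M →
  ¬minor (minor-mono (λ v∈ → x∈p∧x∉q⇒x∈p─q ∈⊤ (x∈∁p⇒x∉p v∈)) (fromMinorModel M)))
  where open Models T G
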